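{- Let $P$ be a program with causal-choice rules over the signature $\langle At, Lb\rangle$, let $R\in P$ be a causal-choice rule, and let $I$ be a standard (two-valued) interpretation. Then $I$ is a standard stable model of $P$ if and only if $I$ is a standard stable model of $\mathtt{ch}(R,P)$.
   Context: **Programs.** A signature is a pair $\langle At, Lb\rangle$ of a set of atoms and a set of labels, with $At \subseteq Lb$. An (ordinary) rule has the form $r_i:\ H_1 \vee \dots \vee H_l \vee \mathrm{not}\,H_{l+1}\vee\dots\vee \mathrm{not}\,H_k \leftarrow B_1,\dots,B_m,\mathrm{not}\,B_{m+1},\dots,\mathrm{not}\,B_n$ with $0\le l\le k$, $0\le m\le n$, label $r_i\in Lb$ and all $H_j,B_j\in At$. A fact $A$ stands for the rule $A: A\leftarrow$. Put $head^+=\{H_1,\dots,H_l\}$, $head^-=\{H_{l+1},\dots,H_k\}$, $body^+=\{B_1,\dots,B_m\}$, $body^-=\{B_{m+1},\dots,B_n\}$. A rule is positive if $head^-=body^-=\emptyset$. A causal-choice rule $R$ is an expression of the same form with the arrow $\leftarrow$ replaced by a different arrow symbol $\leftsquigarrow$; $rule(R)$ denotes the ordinary rule obtained by replacing $\leftsquigarrow$ by $\leftarrow$. A program with causal-choice rules is a set of ordinary rules and causal-choice rules. For a causal-choice rule $R\in P$ of the form $r_i:\ H_1 \vee \dots \vee H_l \vee \mathrm{not}\,H_{l+1}\vee\dots\vee \mathrm{not}\,H_k \leftsquigarrow B_1,\dots,B_m,\mathrm{not}\,B_{m+1},\dots,\mathrm{not}\,B_n$, $\mathtt{ch}(R,P)$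 is the program obtained from $P$ by replacing $R$ by the set consisting, for each atom $H_j\in head^+(R)$ ($1\le j\le l$), of the ordinary rule $$r_i:\ H_1\vee\dots\vee H_j\vee \mathrm{not}\,H_j\vee\dots\vee H_l\vee \mathrm{not}\,H_{l+1}\vee\dots\vee\mathrm{not}\,H_k\leftarrow B_1,\dots,B_m,\mathrm{not}\,B_{m+1},\dots,\mathrm{not}\,B_n .$$ **Causal values.** Terms are built recursively: every label $l\in Lb$ is a term; $\prod S$ and $\sum S$ are terms for every (possibly empty, possibly infinite) set $S$ of terms; $t_1\cdot t_2$ is a term for terms $t_1,t_2$. Finite products and sums are written $t_1*\dots*t_n$ and $t_1+\dots+t_n$; $0$ is the empty sum and $1$ the empty product. Causal values are the equivalence classes of terms under the axioms of a completely distributive complete lattice with meet $*$ and join $+$, together with the following axioms, where $t,u,w$ are terms, $l$ is a label and $c,d,e$ are terms without addition: associativity $t\cdot(u\cdot w)=(t\cdot u)\cdot w$; absorption $t=t+u\cdot t\cdot w$ and $u\cdot t\cdot w=t*(u\cdot t\cdot w)$; identity $t=1\cdot t=t\cdot 1$; annihilator $0=t\cdot 0=0\cdot t$; idempotence $l\cdot l=l$; addition distributivity $t\cdot(u+w)=(t\cdot u)+(t\cdot w)$ and $(t+u)\cdot w=(t\cdot w)+(u\cdot w)$; product distributivity $c\cdot d\cdot e=(c\cdot d)*(d\cdot e)$ when $d\ne 1$, $c\cdot(d*e)=(c\cdot d)*(c\cdot e)$, $(c*d)\cdot e=(c\cdot e)*(d\cdot e)$; addition and product distributivity also hold over infinite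 sums and products. The lattice order is $t\le u$ iff $t*u=t$ iff $t+u=u$; $1$ is the top and $0$ the bottom. **Interpretations and models.** An interpretation is a map $I$ from $At$ to the set of causal values; it is standard (two-valued) if its values lie in $\{0,1\}$. $I(\mathrm{not}\,A)=1$ if $I(A)=0$, and $0$ otherwise. $\mathrm{Atoms}(I)=\{A\in At: I(A)\ne 0\}$. For an ordinary rule, let $b=I(B_1)*\dots*I(B_m)*I(\mathrm{not}\,B_{m+1})*\dots*I(\mathrm{not}\,B_n)$ (with $b=1$ for the empty body). $I$ satisfies the rule iff $b\cdot r_i\cdot H_j\le I(H_j)$ for some $H_j\in head^+$; if $head^+=\emptyset$, $I$ satisfies it iff $b=0$. $I$ is a model of a program of ordinary rules iff it satisfies all its rules; a standard model is a model that is a standard interpretation. **Reduct and standard stable models.** The reduct $P^I$ of a program $P$ with causal-choice rules w.r.t. an interpretation $I$ is obtained by: (1) removing every causal-choice rule $R$ such that $I$ does not satisfy $rule(R)$; (2) replacing each remaining causal-choice rule $R$ by $rule(R)$; (3) in the result, removing all rules with $I(B)\neq 0$ for some $B\in body^-$, removing all rules with $I(B)=0$ for some $B\in head^-$, and removing all negative literals from the remaining rules. Thus $P^I$ is a positive program. $I\le J$ iff $I(A)\le J(A)$ for all $A\in At$; $I\sqsubseteq J$ iff $I\le J$ or $\mathrm{Atoms}(I)\subsetneq \mathrm{Atoms}(J)$; $I\sqsubset J$ iff $I\sqsubseteq J$ and $I\neq J$. A standard stable model of a positive program is a standard model $I$ of it such that no standard model $J$ of it satisfies $J\sqsubset I$.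 A standard interpretation $I$ is a standard stable model of a program $P$ (possibly with causal-choice rules) iff $I$ is a standard stable model of $P^I$. -}

module Defs where

open import Data.Bool.Base using (if_then_else_)
open import Data.Empty using (⊥)
open import Data.Fin.Base using (zero; suc)
open import Data.List.Base using (List; []; _∷_; _++_; map; lookup)
open import Data.List.Relation.Unary.Any using (Any)
import Data.List.Membership.Propositional as List
open import Data.Product.Base using (∃; ∃-syntax; Σ-syntax; _×_; _,_; proj₁; proj₂)
open import Data.Sum.Base using (_⊎_; inj₁; inj₂)
open import Data.Unit.Base using (⊤; tt)
open import Function.Bundles using (_⇔_; _↣_; mk⇔; Equivalence; Injection)
open import Level using (0ℓ) renaming (suc to lsuc)
open import Relation.Binary.PropositionalEquality.Core using (_≡_; _≢_; refl)
open import Relation.Nullary using (¬_; Dec; yes; no; does)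
open import Relation.Unary using (Pred; _∈_; _⊂_)

record Signature : Set₁ where
  field
    At Lb : Set
    At↣Lb : At ↣ Lb

module CausalPrograms (S : Signature) where
  open Signature S public

  infixl 8 _·_
  infixl 7 _*_
  infixl 6 _+_
  infix  4 _≈_ _≤_

  -- A set of terms is given as the image of a family over a small type.
  data Term : Set₁ where
    label : Lb → Term
    ∏ ∑   : {X : Set} → (X → Term) → Term
    _·_   : Term → Term → Term

  ∏ˡ ∑ˡ : List Term → Term
  ∏ˡ ts = ∏ (lookup ts)
  ∑ˡ ts = ∑ (lookup ts)

  _*_ _+_ : Term → Term → Term
  t * u = ∏ˡ (t ∷ u ∷ [])
  t + u = ∑ˡ (t ∷ u ∷ [])

  𝟏 𝟎 : Term
  𝟏 = ∏ˡ []
  𝟎 = ∑ˡ []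

  -- "Without addition" also excludes 𝟎, which is the empty sum.
  NoSum : Term → Set
  NoSum (label l) = ⊤
  NoSum (∏ f)     = ∀ x → NoSum (f x)
  NoSum (∑ f)     = ⊥
  NoSum (t · u)   = NoSum t × NoSum u

  -- Truth of a term, reading ∏ and · as conjunction and ∑ as disjunction.
  Holds : (Lb → Set) → Term → Set
  Holds v (label l) = v l
  Holds v (∏ f)     = ∀ x → Holds v (f x)
  Holds v (∑ f)     = ∃ λ x → Holds v (f x)
  Holds v (t · u)   = Holds v t × Holds v u

  -- The side condition d ≠ 1 below cannot be written ¬ (d ≈ 𝟏) inside the
  -- inductive definition of _≈_ (it would be a negative occurrence).
  -- IsOne is the same condition, see isOne⇔≈𝟏.
  IsOne : Term → Set
  IsOne = Holds (λ _ → ⊥)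

  -- Causal values are terms up to _≈_.
  data _≈_ : Term → Term → Set₁
  _≤_ : Term → Term → Set₁
  t ≤ u = t * u ≈ t

  data _≈_ where
    ≈-refl  : ∀ {t} → t ≈ t
    ≈-sym   : ∀ {t u} → t ≈ u → u ≈ t
    ≈-trans : ∀ {t u w} → t ≈ u → u ≈ w → t ≈ w
    ∏-cong  : ∀ {X : Set} {f g : X → Term} → (∀ x → f x ≈ g x) → ∏ f ≈ ∏ g
    ∑-cong  : ∀ {X : Set} {f g : X → Term} → (∀ x → f x ≈ g x) → ∑ f ≈ ∑ g
    ·-cong  : ∀ {t t′ u u′} → t ≈ t′ → u ≈ u′ → t · u ≈ t′ · u′

    -- completely distributive complete lattice
    *-comm      : ∀ t u → t * u ≈ u * t
    +-comm      : ∀ t u → t + u ≈ u + t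
    *-assoc     : ∀ t u w → t * u * w ≈ t * (u * w)
    +-assoc     : ∀ t u w → t + u + w ≈ t + (u + w)
    *-absorbs-+ : ∀ t u → t * (t + u) ≈ t
    +-absorbs-* : ∀ t u → t + t * u ≈ t
    ∏-lower     : ∀ {X : Set} (f : X → Term) x → ∏ f ≤ f x
    ∏-greatest  : ∀ {X : Set} (f : X → Term) t → (∀ x → t ≤ f x) → t ≤ ∏ f
    ∑-upper     : ∀ {X : Set} (f : X → Term) x → f x ≤ ∑ f
    ∑-least     : ∀ {X : Set} (f : X → Term) t → (∀ x → f x ≤ t) → ∑ f ≤ t
    ∏-distrib-∑ : ∀ {X : Set} {Y : X → Set} (f : ∀ x → Y x → Term) →
                  ∏ (λ x → ∑ (f x)) ≈ ∑ (λ (c : ∀ x → Y x) → ∏ (λ x → f x (c x)))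

    -- application
    ·-assoc       : ∀ t u w → t · (u · w) ≈ t · u · w
    +-absorbs-·   : ∀ t u w → t ≈ t + u · t · w
    *-absorbs-·   : ∀ t u w → u · t · w ≈ t * (u · t · w)
    ·-identityˡ   : ∀ t → t ≈ 𝟏 · t
    ·-identityʳ   : ∀ t → t ≈ t · 𝟏
    ·-zeroˡ       : ∀ t → 𝟎 ≈ 𝟎 · t
    ·-zeroʳ       : ∀ t → 𝟎 ≈ t · 𝟎
    label-idem    : ∀ l → label l · label l ≈ label l
    ·-distribˡ-+  : ∀ t u w → t · (u + w) ≈ t · u + t · w
    ·-distribʳ-+  : ∀ t u w → (t + u) · w ≈ t · w + u · w
    ·-distribˡ-∑  : ∀ {X : Set} t (f : X → Term) → t · ∑ f ≈ ∑ (λ x → t · f x)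
    ·-distribʳ-∑  : ∀ {X : Set} t (f : X → Term) → ∑ f · t ≈ ∑ (λ x → f x · t)
    ·-split       : ∀ c d e → NoSum c → NoSum d → NoSum e → ¬ IsOne d →
                    c · d · e ≈ (c · d) * (d · e)
    ·-distribˡ-*  : ∀ c d e → NoSum c → NoSum d → NoSum e →
                    c · (d * e) ≈ (c · d) * (c · e)
    ·-distribʳ-*  : ∀ c d e → NoSum c → NoSum d → NoSum e →
                    (c * d) · e ≈ (c · e) * (d · e)
    -- Only over non-empty products: the empty case would read c ≈ 𝟏.
    ·-distribˡ-∏  : ∀ {X : Set} c (f : X → Term) → X → NoSum c → (∀ x → NoSum (f x)) →
                    c · ∏ f ≈ ∏ (λ x → c · f x)
    ·-distribʳ-∏  : ∀ {X : Set} c (f : X → Term) → X → NoSum c → (∀ x → NoSum (f x)) →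
                    ∏ f · c ≈ ∏ (λ x → f x · c)

  private
    pattern #0 = zero
    pattern #1 = suc zero

    both : ∀ {v t u} → Holds v t → Holds v u → Holds v (t * u)
    both p q #0 = p
    both p q #1 = q

  -- Soundness of the two-valued reading; in particular _≈_ is not total.
  sound : ∀ v {t u} → t ≈ u → Holds v t ⇔ Holds v u
  sound v e = mk⇔ (to e) (from e)
    where
    to   : ∀ {t u} → t ≈ u → Holds v t → Holds v u
    from : ∀ {t u} → t ≈ u → Holds v u → Holds v t

    to ≈-refl p = p
    to (≈-sym e) p = from e p
    to (≈-trans e e′) p = to e′ (to e p)
    to (∏-cong e) p x = to (e x) (p x)
    to (∑-cong e) (x , p) = x , to (e x) p
    to (·-cong e e′) (p , q) = to e p , to e′ q
    to (*-comm t u) p = both {t = u} {u = t} (p #1) (p #0)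
    to (+-comm t u) (#0 , p) = #1 , p
    to (+-comm t u) (#1 , p) = #0 , p
    to (*-assoc t u w) p = both {t = t} {u = u * w} (p #0 #0) (both {t = u} {u = w} (p #0 #1) (p #1))
    to (+-assoc t u w) (#0 , #0 , p) = #0 , p
    to (+-assoc t u w) (#0 , #1 , p) = #1 , #0 , p
    to (+-assoc t u w) (#1 , p) = #1 , #1 , p
    to (*-absorbs-+ t u) p = p #0
    to (+-absorbs-* t u) (#0 , p) = p
    to (+-absorbs-* t u) (#1 , p) = p #0
    to (∏-lower f x) p = p #0
    to (∏-greatest f t e) p = p #0
    to (∑-upper f x) p = p #0
    to (∑-least f t e) p = p #0
    to (∏-distrib-∑ f) p = (λ x → proj₁ (p x)) , λ x → proj₂ (p x)
    to (·-assoc t u w) (p , q , r) = (p , q) , r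
    to (+-absorbs-· t u w) p = #0 , p
    to (*-absorbs-· t u w) p = both {t = t} {u = u · t · w} (proj₂ (proj₁ p)) p
    to (·-identityˡ t) p = (λ ()) , p
    to (·-identityʳ t) p = p , λ ()
    to (·-zeroˡ t) (() , _)
    to (·-zeroʳ t) (() , _)
    to (label-idem l) p = proj₁ p
    to (·-distribˡ-+ t u w) (p , #0 , q) = #0 , p , q
    to (·-distribˡ-+ t u w) (p , #1 , q) = #1 , p , q
    to (·-distribʳ-+ t u w) ((#0 , p) , q) = #0 , p , q
    to (·-distribʳ-+ t u w) ((#1 , p) , q) = #1 , p , q
    to (·-distribˡ-∑ t f) (p , x , q) = x , p , q
    to (·-distribʳ-∑ t f) ((x , p) , q) = x , p , q
    to (·-split c d e _ _ _ _) ((p , q) , r) = both {t = c · d} {u = d · e} (p , q) (q , r)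
    to (·-distribˡ-* c d e _ _ _) (p , q) = both {t = c · d} {u = c · e} (p , q #0) (p , q #1)
    to (·-distribʳ-* c d e _ _ _) (p , q) = both {t = c · e} {u = d · e} (p #0 , q) (p #1 , q)
    to (·-distribˡ-∏ c f _ _ _) (p , q) x = p , q x
    to (·-distribʳ-∏ c f _ _ _) (p , q) x = p x , q

    from ≈-refl p = p
    from (≈-sym e) p = to e p
    from (≈-trans e e′) p = from e (from e′ p)
    from (∏-cong e) p x = from (e x) (p x)
    from (∑-cong e) (x , p) = x , from (e x) p
    from (·-cong e e′) (p , q) = from e p , from e′ q
    from (*-comm t u) p = both {t = t} {u = u} (p #1) (p #0)
    from (+-comm t u) (#0 , p) = #1 , p
    from (+-comm t u) (#1 , p) = #0 , p
    from (*-assoc t u w) p = both {t = t * u} {u = w} (both {t = t} {u = u} (p #0) (p #1 #0)) (p #1 #1)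
    from (+-assoc t u w) (#0 , p) = #0 , #0 , p
    from (+-assoc t u w) (#1 , #0 , p) = #0 , #1 , p
    from (+-assoc t u w) (#1 , #1 , p) = #1 , p
    from (*-absorbs-+ t u) p = both {t = t} {u = t + u} p (#0 , p)
    from (+-absorbs-* t u) p = #0 , p
    from (∏-lower f x) p = both {t = ∏ f} {u = f x} p (p x)
    from (∏-greatest f t e) p = both {t = t} {u = ∏ f} p (λ x → from (e x) p #1)
    from (∑-upper f x) p = both {t = f x} {u = ∑ f} p (x , p)
    from (∑-least f t e) (x , p) = both {t = ∑ f} {u = t} (x , p) (from (e x) p #1)
    from (∏-distrib-∑ f) (c , p) x = c x , p x
    from (·-assoc t u w) ((p , q) , r) = p , q , r
    from (+-absorbs-· t u w) (#0 , p) = p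
    from (+-absorbs-· t u w) (#1 , p) = proj₂ (proj₁ p)
    from (*-absorbs-· t u w) p = p #1
    from (·-identityˡ t) p = proj₂ p
    from (·-identityʳ t) p = proj₁ p
    from (·-zeroˡ t) ((() , _) , _)
    from (·-zeroʳ t) (_ , () , _)
    from (label-idem l) p = p , p
    from (·-distribˡ-+ t u w) (#0 , p , q) = p , #0 , q
    from (·-distribˡ-+ t u w) (#1 , p , q) = p , #1 , q
    from (·-distribʳ-+ t u w) (#0 , p , q) = (#0 , p) , q
    from (·-distribʳ-+ t u w) (#1 , p , q) = (#1 , p) , q
    from (·-distribˡ-∑ t f) (x , p , q) = p , x , q
    from (·-distribʳ-∑ t f) (x , p , q) = (x , p) , q
    from (·-split c d e _ _ _ _) p = p #0 , proj₂ (p #1)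
    from (·-distribˡ-* c d e _ _ _) p =
      proj₁ (p #0) , both {t = d} {u = e} (proj₂ (p #0)) (proj₂ (p #1))
    from (·-distribʳ-* c d e _ _ _) p =
      both {t = c} {u = d} (proj₁ (p #0)) (proj₁ (p #1)) , proj₂ (p #0)
    from (·-distribˡ-∏ c f x₀ _ _) p = proj₁ (p x₀) , λ x → proj₂ (p x)
    from (·-distribʳ-∏ c f x₀ _ _) p = (λ x → proj₁ (p x)) , proj₂ (p x₀)

  ≤-refl : ∀ {t} → t ≤ t
  ≤-refl {t} = ≈-trans
    (∏-cong λ { #0 → ≈-refl ; #1 → ≈-sym (+-absorbs-* t t) })
    (*-absorbs-+ t (t * t))

  ≤-antisym : ∀ {t u} → t ≤ u → u ≤ t → t ≈ u
  ≤-antisym {t} {u} p q = ≈-trans (≈-sym p) (≈-trans (*-comm t u) q)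

  ≤-respʳ-≈ : ∀ {t u w} → u ≈ w → t ≤ u → t ≤ w
  ≤-respʳ-≈ e p = ≈-trans (∏-cong λ { #0 → ≈-refl ; #1 → ≈-sym e }) p

  ≤-respˡ-≈ : ∀ {t u w} → t ≈ u → t ≤ w → u ≤ w
  ≤-respˡ-≈ e p = ≈-trans (∏-cong λ { #0 → ≈-sym e ; #1 → ≈-refl }) (≈-trans p e)

  ≤-𝟏 : ∀ t → t ≤ 𝟏
  ≤-𝟏 t = ∏-greatest _ t λ ()

  isOne⇔≈𝟏 : ∀ t → IsOne t ⇔ t ≈ 𝟏
  isOne⇔≈𝟏 t = mk⇔ (to t) (λ e → Equivalence.from (sound _ e) λ ())
    where
    to : ∀ t → IsOne t → t ≈ 𝟏
    to (∏ f) p = ≤-antisym (≤-𝟏 _)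
      (∏-greatest f 𝟏 λ x → ≤-respʳ-≈ (≈-sym (to (f x) (p x))) ≤-refl)
    to (∑ f) (x , p) = ≤-antisym (≤-𝟏 _) (≤-respˡ-≈ (to (f x) p) (∑-upper f x))
    to (t · u) (p , q) = ≈-trans (·-cong (to t p) (to u q)) (≈-sym (·-identityˡ 𝟏))

  𝟏≉𝟎 : ¬ 𝟏 ≈ 𝟎
  𝟏≉𝟎 e with Equivalence.to (sound (λ _ → ⊤) e) (λ ())
  ... | () , _

  -- The value of "not A" is defined by cases on whether A has value 𝟎, so
  -- an interpretation carries the decision. For two-valued maps this is
  -- automatic, see twoValued.
  record Interpretation : Set₁ where
    field
      value : At → Term
      zero? : ∀ A → Dec (value A ≈ 𝟎)

    notValue : At → Term
    notValue A = if does (zero? A) then 𝟏 else 𝟎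

  open Interpretation public

  TwoValued : (At → Term) → Set₁
  TwoValued v = ∀ A → v A ≈ 𝟎 ⊎ v A ≈ 𝟏

  twoValued : (v : At → Term) → TwoValued v → Interpretation
  twoValued v two = record { value = v ; zero? = λ A → decide (two A) }
    where
    decide : ∀ {t} → t ≈ 𝟎 ⊎ t ≈ 𝟏 → Dec (t ≈ 𝟎)
    decide (inj₁ e) = yes e
    decide (inj₂ e) = no λ e′ → 𝟏≉𝟎 (≈-trans (≈-sym e) e′)

  Standard : Interpretation → Set₁
  Standard I = TwoValued (value I)

  Atoms : Interpretation → Pred At (lsuc 0ℓ)
  Atoms I A = ¬ value I A ≈ 𝟎

  infix 4 _≈ᴵ_ _≤ᴵ_ _⊑_ _⊏_

  _≈ᴵ_ _≤ᴵ_ _⊑_ _⊏_ : Interpretation → Interpretation → Set₁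
  I ≈ᴵ J = ∀ A → value I A ≈ value J A
  I ≤ᴵ J = ∀ A → value I A ≤ value J A
  I ⊑ J  = I ≤ᴵ J ⊎ Atoms I ⊂ Atoms J
  I ⊏ J  = I ⊑ J × ¬ I ≈ᴵ J

  record Rule : Set where
    field
      name                    : Lb
      head⁺ head⁻ body⁺ body⁻ : List At

  open Rule public

  data ProgramRule : Set where
    ordinary choice : Rule → ProgramRule

  OrdinaryProgram Program : Set₂
  OrdinaryProgram = Pred Rule (lsuc 0ℓ)
  Program         = Pred ProgramRule (lsuc 0ℓ)

  Positive : Rule → Set
  Positive r = head⁻ r ≡ [] × body⁻ r ≡ []

  bodyValue : Interpretation → Rule → Term
  bodyValue I r = ∏ˡ (map (value I) (body⁺ r) ++ map (notValue I) (body⁻ r))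

  atom : At → Term
  atom A = label (Injection.to At↣Lb A)

  -- head⁻ plays no role in satisfaction.
  Satisfies : Interpretation → Rule → Set₁
  Satisfies I r = go (head⁺ r)
    where
    go : List At → Set₁
    go []         = bodyValue I r ≈ 𝟎
    go Hs@(_ ∷ _) = Any (λ H → bodyValue I r · label (name r) · atom H ≤ value I H) Hs

  Model StandardModel : Interpretation → OrdinaryProgram → Set₁
  Model I Q         = ∀ r → r ∈ Q → Satisfies I r
  StandardModel I Q = Standard I × Model I Q

  selected : Interpretation → Program → OrdinaryProgram
  selected I P r = ordinary r ∈ P ⊎ (choice r ∈ P × Satisfies I r)

  removed : Interpretation → Rule → Set₁
  removed I r = Any (λ B → ¬ value I B ≈ 𝟎) (body⁻ r) ⊎ Any (λ B → value I B ≈ 𝟎) (head⁻ r)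

  strip : Rule → Rule
  strip r = record r { head⁻ = [] ; body⁻ = [] }

  reduct : Interpretation → Program → OrdinaryProgram
  reduct I P r = ∃[ q ] q ∈ selected I P × ¬ removed I q × r ≡ strip q

  reduct-positive : ∀ I P r → r ∈ reduct I P → Positive r
  reduct-positive I P _ (_ , _ , _ , refl) = refl , refl

  PositiveProgram : Set₂
  PositiveProgram = Σ[ Q ∈ OrdinaryProgram ] (∀ r → r ∈ Q → Positive r)

  StandardStableModel⁺ : Interpretation → PositiveProgram → Set₁
  StandardStableModel⁺ I (Q , _) =
    StandardModel I Q × (∀ J → StandardModel J Q → ¬ J ⊏ I)

  StandardStableModel : Interpretation → Program → Set₁
  StandardStableModel I P =
    Standard I × StandardStableModel⁺ I (reduct I P , reduct-positive I P)

  ch : Rule → Program → Program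
  ch R P q =
      (q ∈ P × q ≢ choice R)
    ⊎ (∃[ H ] H List.∈ head⁺ R × q ≡ ordinary (record R { head⁻ = H ∷ head⁻ R }))

{-# OPTIONS --safe #-}
-- The rules of ch(R,P) coming from R all reduce to the positive part of R, and
-- one of them survives in the reduct iff R is not removed and I(H) ≠ 0 for some
-- H ∈ head⁺(R). Hence the two reducts differ at most by the positive part of R,
-- and when only P^I contains it, the positive body of R is 0 in I. It is then
-- also 0 in every standard J ⊑ I, so the additional rule rejects no such J.
-- Atoms and labels need not have decidable equality, so whether a rule of P is
-- R is only available under double negation; this suffices because
-- satisfaction by a standard interpretation is decidable.
module Submission where

open import Data.Empty using (⊥-elim)
open import Data.List.Base using ([]; _∷_; _++_; lookup; map)
open import Data.List.Membership.Propositional using (lose; find)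
open import Data.List.Membership.Propositional.Properties using (∈-lookup)
open import Data.List.Relation.Unary.All as All using (All; []; _∷_)
import Data.List.Relation.Unary.All.Properties as All
open import Data.List.Relation.Unary.Any as Any using (Any; here; there; any?)
import Data.List.Relation.Unary.Any.Properties as Any
open import Data.Product.Base using (_,_)
open import Data.Sum.Base using (_⊎_; inj₁; inj₂; [_,_]′)
open import Data.Unit.Base using (⊤; tt)
open import Function.Base using (_∘_; id)
open import Function.Bundles using (_⇔_; mk⇔; Equivalence)
open import Relation.Binary.PropositionalEquality.Core using (refl)
open import Relation.Nullary using (¬_; Dec; yes; no)
open import Relation.Nullary.Decidable using (decidable-stable; _⊎-dec_)
import Relation.Nullary.Decidable as Dec
open import Relation.Unary using (_∈_; _⊆_)
open import Defs

module Choice (S : Signature) where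
  open CausalPrograms S

  IsBit : Term → Set₁
  IsBit t = t ≈ 𝟎 ⊎ t ≈ 𝟏

  𝟎-min : ∀ t → 𝟎 ≤ t
  𝟎-min t = ∑-least _ t λ ()

  ≤𝟎⇒≈𝟎 : ∀ {t u} → u ≈ 𝟎 → t ≤ u → t ≈ 𝟎
  ≤𝟎⇒≈𝟎 u≈𝟎 t≤u = ≤-antisym (≤-respʳ-≈ u≈𝟎 t≤u) (𝟎-min _)

  isZero? : ∀ {t} → IsBit t → Dec (t ≈ 𝟎)
  isZero? (inj₁ t≈𝟎) = yes t≈𝟎
  isZero? (inj₂ t≈𝟏) = no λ t≈𝟎 → 𝟏≉𝟎 (≈-trans (≈-sym t≈𝟏) t≈𝟎)

  isOne? : ∀ {t} → IsBit t → Dec (t ≈ 𝟏)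
  isOne? (inj₁ t≈𝟎) = no λ t≈𝟏 → 𝟏≉𝟎 (≈-trans (≈-sym t≈𝟏) t≈𝟎)
  isOne? (inj₂ t≈𝟏) = yes t≈𝟏

  ≉𝟎⇒≈𝟏 : ∀ {t} → IsBit t → ¬ t ≈ 𝟎 → t ≈ 𝟏
  ≉𝟎⇒≈𝟏 bit t≉𝟎 = [ ⊥-elim ∘ t≉𝟎 , id ]′ bit

  -- When every label is read as true, the left side holds and `𝟎` does not, so `sound` rules out
  -- the inequality.
  label·label≰𝟎 : ∀ {t u} k l → t ≈ 𝟏 → u ≈ 𝟎 → ¬ t · label k · label l ≤ u
  label·label≰𝟎 k l t≈𝟏 u≈𝟎 p
    with Equivalence.to (sound (λ _ → ⊤) (≤𝟎⇒≈𝟎 u≈𝟎 p))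
           ((Equivalence.from (sound _ t≈𝟏) (λ ()) , tt) , tt)
  ... | () , _

  Any≈𝟎⇒∏ˡ≈𝟎 : ∀ {ts} → Any (_≈ 𝟎) ts → ∏ˡ ts ≈ 𝟎
  Any≈𝟎⇒∏ˡ≈𝟎 {ts} p = ≤𝟎⇒≈𝟎 (Any.lookup-index p) (∏-lower (lookup ts) (Any.index p))

  All≈𝟏⇒∏ˡ≈𝟏 : ∀ {ts} → All (_≈ 𝟏) ts → ∏ˡ ts ≈ 𝟏
  All≈𝟏⇒∏ˡ≈𝟏 {ts} ps = ≤-antisym (≤-𝟏 _)
    (∏-greatest (lookup ts) 𝟏 λ i → ≤-respʳ-≈ (≈-sym (All.lookup ps (∈-lookup i))) ≤-refl)

  Any≈𝟎⊎All≈𝟏 : ∀ {ts} → All IsBit ts → Any (_≈ 𝟎) ts ⊎ All (_≈ 𝟏) ts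
  Any≈𝟎⊎All≈𝟏 []              = inj₂ []
  Any≈𝟎⊎All≈𝟏 (inj₁ p ∷ _)    = inj₁ (here p)
  Any≈𝟎⊎All≈𝟏 (inj₂ p ∷ bits) =
    [ inj₁ ∘ there , inj₂ ∘ (p ∷_) ]′ (Any≈𝟎⊎All≈𝟏 bits)

  ∏ˡ-isBit : ∀ {ts} → All IsBit ts → IsBit (∏ˡ ts)
  ∏ˡ-isBit = [ inj₁ ∘ Any≈𝟎⇒∏ˡ≈𝟎 , inj₂ ∘ All≈𝟏⇒∏ˡ≈𝟏 ]′ ∘ Any≈𝟎⊎All≈𝟏

  ∏ˡ≈𝟎⇒Any≈𝟎 : ∀ {ts} → All IsBit ts → ∏ˡ ts ≈ 𝟎 → Any (_≈ 𝟎) ts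
  ∏ˡ≈𝟎⇒Any≈𝟎 bits e with Any≈𝟎⊎All≈𝟏 bits
  ... | inj₁ p  = p
  ... | inj₂ ps = ⊥-elim (𝟏≉𝟎 (≈-trans (≈-sym (All≈𝟏⇒∏ˡ≈𝟏 ps)) e))

  notValue-isBit : ∀ I A → IsBit (notValue I A)
  notValue-isBit I A with zero? I A
  ... | yes _ = inj₂ ≈-refl
  ... | no  _ = inj₁ ≈-refl

  notValue≈𝟎⇒value≉𝟎 : ∀ I A → notValue I A ≈ 𝟎 → ¬ value I A ≈ 𝟎
  notValue≈𝟎⇒value≉𝟎 I A e with zero? I A
  ... | yes _  = ⊥-elim (𝟏≉𝟎 e)
  ... | no  ¬p = ¬p

  literals-areBits : ∀ I → Standard I → ∀ r →
    All IsBit (map (value I) (body⁺ r) ++ map (notValue I) (body⁻ r))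
  literals-areBits I std r = All.++⁺
    (All.map⁺ (All.universal std (body⁺ r)))
    (All.map⁺ (All.universal (notValue-isBit I) (body⁻ r)))

  bodyValue-isBit : ∀ I → Standard I → ∀ r → IsBit (bodyValue I r)
  bodyValue-isBit I std r = ∏ˡ-isBit (literals-areBits I std r)

  -- Classical satisfaction: it treats an empty `head⁺` uniformly, and for a standard interpretation
  -- both disjuncts are decidable.
  Satisfies₂ : Interpretation → Rule → Set₁
  Satisfies₂ I r = bodyValue I r ≈ 𝟎 ⊎ Any (λ H → value I H ≈ 𝟏) (head⁺ r)

  -- With body value `𝟏` the derived term is not below `𝟎`, so its head atom must have value `𝟏`;
  -- conversely, `𝟏` bounds every term.
  satisfies⇔satisfies₂ : ∀ I → Standard I → ∀ r → Satisfies I r ⇔ Satisfies₂ I r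
  satisfies⇔satisfies₂ I std r@(record { head⁺ = [] }) = mk⇔ inj₁ λ { (inj₁ e) → e ; (inj₂ ()) }
  satisfies⇔satisfies₂ I std r@(record { head⁺ = H₀ ∷ Hs }) = mk⇔ to from
    where
    Derives : At → Set₁
    Derives H = bodyValue I r · label (name r) · atom H ≤ value I H

    to : Any Derives (H₀ ∷ Hs) → Satisfies₂ I r
    to p with bodyValue-isBit I std r
    ... | inj₁ b≈𝟎 = inj₁ b≈𝟎
    ... | inj₂ b≈𝟏 = inj₂ (Any.map
      (λ {H} d → ≉𝟎⇒≈𝟏 (std H) λ H≈𝟎 → label·label≰𝟎 _ _ b≈𝟏 H≈𝟎 d) p)

    from : Satisfies₂ I r → Any Derives (H₀ ∷ Hs)
    -- A zero body makes the derived term `𝟎`, so any head atom serves as witness.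
    from (inj₁ b≈𝟎) = here (≤-respˡ-≈ (≈-sym lhs≈𝟎) (𝟎-min _))
      where
      lhs≈𝟎 : bodyValue I r · label (name r) · atom H₀ ≈ 𝟎
      lhs≈𝟎 = ≈-trans
        (·-cong (≈-trans (·-cong b≈𝟎 ≈-refl) (≈-sym (·-zeroˡ _))) ≈-refl)
        (≈-sym (·-zeroˡ _))
    from (inj₂ p) = Any.map (λ H≈𝟏 → ≤-respʳ-≈ (≈-sym H≈𝟏) (≤-𝟏 _)) p

  satisfies? : ∀ I → Standard I → ∀ r → Dec (Satisfies I r)
  satisfies? I std r = Dec.map′ (Equivalence.from e) (Equivalence.to e)
    (isZero? (bodyValue-isBit I std r) ⊎-dec any? (isOne? ∘ std) (head⁺ r))
    where e = satisfies⇔satisfies₂ I std r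

  -- Inclusion of atom sets only refutes that `J` is nonzero at `A`; two-valuedness of `J` removes
  -- the double negation.
  ⊑⇒zero : ∀ {I J} → Standard J → J ⊑ I → ∀ {A} → value I A ≈ 𝟎 → value J A ≈ 𝟎
  ⊑⇒zero stdJ (inj₁ J≤I) {A} I≈𝟎 = ≤𝟎⇒≈𝟎 I≈𝟎 (J≤I A)
  ⊑⇒zero stdJ (inj₂ (J⊆I , _)) {A} I≈𝟎 =
    decidable-stable (isZero? (stdJ A)) λ J≉𝟎 → J⊆I J≉𝟎 I≈𝟎

  -- If r survives in the reduct w.r.t. I, its negative body literals are 1 in I.
  strip-body≈𝟎 : ∀ {I J} r → Standard I → Standard J → J ⊑ I → ¬ removed I r →
    bodyValue I r ≈ 𝟎 → bodyValue J (strip r) ≈ 𝟎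
  strip-body≈𝟎 {I} {J} r stdI stdJ J⊑I ¬rem b≈𝟎
    with Any.++⁻ (map (value I) (body⁺ r)) (∏ˡ≈𝟎⇒Any≈𝟎 (literals-areBits I stdI r) b≈𝟎)
  ... | inj₁ p = Any≈𝟎⇒∏ˡ≈𝟎
    (Any.++⁺ˡ (Any.map⁺ (Any.map (⊑⇒zero {I} {J} stdJ J⊑I) (Any.map⁻ p))))
  ... | inj₂ p = ⊥-elim
    (¬rem (inj₁ (Any.map (λ {B} → notValue≈𝟎⇒value≉𝟎 I B) (Any.map⁻ p))))

  -- A surviving variant of `R` has its `H` in `head⁻`, so `I` is nonzero at `H`. As `H` is also in
  -- `head⁺ R`, `I` satisfies `R`, which is therefore selected.
  reduct-ch⊆reduct : ∀ {P R I} → choice R ∈ P → Standard I →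
    reduct I (ch R P) ⊆ reduct I P
  reduct-ch⊆reduct R∈P std (q , inj₁ (inj₁ (q∈P , _)) , ¬rem , eq) =
    q , inj₁ q∈P , ¬rem , eq
  reduct-ch⊆reduct {R = R} {I} R∈P std (_ , inj₁ (inj₂ (H , H∈R , refl)) , ¬rem , eq) =
    -- Whatever would remove `R` would also remove its variant, and both have the same `strip`.
    R , inj₂ (R∈P , satisfied) , ¬rem ∘ [ inj₁ , inj₂ ∘ there ]′ , eq
    where
    satisfied : Satisfies I R
    satisfied = Equivalence.from (satisfies⇔satisfies₂ I std R)
      (inj₂ (lose H∈R (≉𝟎⇒≈𝟏 (std H) λ H≈𝟎 → ¬rem (inj₂ (here H≈𝟎)))))
  reduct-ch⊆reduct R∈P std (q , inj₂ (inj₁ (q∈P , _) , sat) , ¬rem , eq) =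
    q , inj₂ (q∈P , sat) , ¬rem , eq
  reduct-ch⊆reduct R∈P std (_ , inj₂ (inj₂ (_ , _ , ()) , _) , _)

  -- Serves twice: with `J` equal to `I` for modelhood, and with `J ⊏ I` for minimality.
  model-reduct-ch⇒model-reduct : ∀ {P R I J} → Standard I → Standard J → J ⊑ I →
    Model J (reduct I (ch R P)) → Model J (reduct I P)
  model-reduct-ch⇒model-reduct {P} {R} {I} {J} stdI stdJ J⊑I J⊨ = J⊨P
    where
    J⊨R : Satisfies I R → ¬ removed I R → Satisfies J (strip R)
    J⊨R sat ¬rem with Equivalence.to (satisfies⇔satisfies₂ I stdI R) sat
    ... | inj₁ b≈𝟎 = Equivalence.from (satisfies⇔satisfies₂ J stdJ (strip R))
      (inj₁ (strip-body≈𝟎 {I} {J} R stdI stdJ J⊑I ¬rem b≈𝟎))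
    ... | inj₂ p with find p
    -- The variant chosen is the one for an atom true in `I`: its added literal in `head⁻` does not
    -- cause removal.
    ...   | H , H∈R , H≈𝟏 = J⊨ (strip R)
      (_ , inj₁ (inj₂ (H , H∈R , refl)) , ¬rem′ , refl)
      where
      ¬rem′ : ¬ removed I (record R { head⁻ = H ∷ head⁻ R })
      ¬rem′ (inj₁ b)           = ¬rem (inj₁ b)
      ¬rem′ (inj₂ (here H≈𝟎))  = 𝟏≉𝟎 (≈-trans (≈-sym H≈𝟏) H≈𝟎)
      ¬rem′ (inj₂ (there h))   = ¬rem (inj₂ h)

    J⊨P : Model J (reduct I P)
    J⊨P _ (q , inj₁ q∈P , ¬rem , refl) =
      J⊨ _ (q , inj₁ (inj₁ (q∈P , λ ())) , ¬rem , refl)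
    J⊨P _ (q , inj₂ (q∈P , sat) , ¬rem , refl) =
      -- If `J` failed `strip q`, then `q` could not be `R`, by `J⊨R`. So `q` would be kept by `ch`,
      -- and `J` would satisfy `strip q` after all.
      decidable-stable (satisfies? J stdJ (strip q)) λ J⊭q →
        J⊭q (J⊨ _ (q , inj₂ (inj₁ (q∈P , λ { refl → J⊭q (J⊨R sat ¬rem) }) , sat) , ¬rem , refl))

theorem5 : (S : Signature) → let open CausalPrograms S in
    (P : Program) (R : Rule) → choice R ∈ P →
    (I : Interpretation) → Standard I →
    StandardStableModel I P ⇔ StandardStableModel I (ch R P)
theorem5 S P R R∈P I std = mk⇔
  (λ (_ , (_ , I⊨) , minimal) →
    std ,
    (std , λ r → I⊨ r ∘ reduct-ch⊆reduct {P} {R} {I} R∈P std) ,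
    λ J (stdJ , J⊨) J⊏I@(J⊑I , _) →
      minimal J (stdJ , model-reduct-ch⇒model-reduct {P} {R} {I} {J} std stdJ J⊑I J⊨) J⊏I)
  (λ (_ , (_ , I⊨) , minimal) →
    std ,
    (std , model-reduct-ch⇒model-reduct {P} {R} {I} {I} std std (inj₁ λ _ → ≤-refl) I⊨) ,
    λ J (stdJ , J⊨) →
      minimal J (stdJ , λ r → J⊨ r ∘ reduct-ch⊆reduct {P} {R} {I} R∈P std))
  where
  open CausalPrograms S
  open Choice S
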